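{- Let $x_1,x_2,x_3,x_4$ be prime numbers and let $a,b$ be positive integers such that (i) $x_1+x_2+x_3+x_4=a^2$; (ii) $\sum_{i=1}^{4}\mathrm{dgs}(x_i)=b^2$; (iii) $\mathrm{dgs}(a^2)+\mathrm{dgs}(b^2)=\mathrm{dgs}(a^2+b^2)$; (iv) $a^2+b^2$ is a prime of the form $4s+1$ for some positive integer $s$. Then $b$ is not a multiple of $3$.
   Context: For a positive integer $n$, $\mathrm{dgs}(n)$ denotes the sum of all digits of $n$ in its decimal representation. The primes $x_1,\dots,x_4$ need not be distinct. -}

module Defs where

open import Data.Digit using (toDigits)
open import Data.Fin.Base using (toℕ)
open import Data.List.Base using (map)
open import Data.Nat.Base using (ℕ)
open import Data.Nat.ListAction using (sum)
open import Data.Product.Base using (proj₁)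

dgs : ℕ → ℕ
dgs n = sum (map toℕ (proj₁ (toDigits 10 n)))

{-# OPTIONS --safe #-}
-- Every n is congruent to dgs n modulo 9, so a² ≡ b² (mod 9).  If 3 divided b,
-- then 9 would divide both squares, hence the prime a² + b², which is impossible.
module Submission where

open import Defs
open import Data.Digit using (Expansion; fromDigits; toDigits)
open import Data.Fin.Base using (toℕ)
open import Data.List.Base using (map; []; _∷_)
open import Data.Nat.Base using (ℕ; suc; _+_; _*_; _^_; _<_)
open import Data.Nat.Divisibility using (_∣_; _∤_; ∣m∣n⇒∣m+n; m∣m*n; *-pres-∣)
open import Data.Nat.ListAction using (sum)
open import Data.Nat.Primality using (Prime; prime?; prime⇒irreducible)
open import Data.Nat.Properties using (*-identityʳ)
open import Data.Nat.Tactic.RingSolver using (solve-∀)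
open import Data.Product.Base using (∃-syntax; _×_; _,_)
open import Data.Sum.Base using (inj₂)
open import Relation.Binary.PropositionalEquality
  using (_≡_; refl; sym; trans; cong; cong₂; subst)
open import Relation.Nullary.Decidable using (from-no)

-- Casting out nines: 10 leaves remainder 1 modulo 9, so `n≡dgs+9*` holds, and adding it over the
-- four primes transfers divisibility by 9 from `b ^ 2` to `a ^ 2`. If 3 divided `b`, the prime
-- `a ^ 2 + b ^ 2` would be a multiple of 9, against `9∤prime`.

fromDigits≡sum+base∸1* : ∀ {b} (ds : Expansion (suc b)) →
  ∃[ k ] fromDigits ds ≡ sum (map toℕ ds) + b * k
fromDigits≡sum+base∸1* {b} []       = 0 , lemma b
  where
  lemma : ∀ b → 0 ≡ 0 + b * 0
  lemma = solve-∀
fromDigits≡sum+base∸1* {b} (d ∷ ds) with fromDigits≡sum+base∸1* ds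
-- If the tail has value n = s + b * k, the Horner step gives n * suc b = n + b * n, so the new
-- quotient is k + n = s + suc b * k.
... | k , eq = sum (map toℕ ds) + suc b * k ,
  trans (cong (λ n → toℕ d + n * suc b) eq) (lemma (toℕ d) (sum (map toℕ ds)) b k)
  where
  lemma : ∀ d s b k → d + (s + b * k) * suc b ≡ d + s + b * (s + suc b * k)
  lemma = solve-∀

n≡dgs+9* : ∀ n → ∃[ k ] n ≡ dgs n + 9 * k
-- The abstraction also reaches inside `dgs n`, so both sides refer to the same digits `ds`.
n≡dgs+9* n with toDigits 10 n
... | ds , eq with fromDigits≡sum+base∸1* ds
... | k , eq′ = k , trans (sym eq) eq′

9∣sum-dgs⇒9∣sum : ∀ w x y z →
  9 ∣ dgs w + dgs x + dgs y + dgs z → 9 ∣ w + x + y + z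
9∣sum-dgs⇒9∣sum w x y z 9∣s
  with n≡dgs+9* w | n≡dgs+9* x | n≡dgs+9* y | n≡dgs+9* z
... | i , w≡ | j , x≡ | k , y≡ | l , z≡ = subst (9 ∣_) (sym sum≡)
  (∣m∣n⇒∣m+n 9∣s (m∣m*n (i + j + k + l)))
  where
  lemma : ∀ p q r s i j k l →
    p + 9 * i + (q + 9 * j) + (r + 9 * k) + (s + 9 * l) ≡
    p + q + r + s + 9 * (i + j + k + l)
  lemma = solve-∀

  sum≡ : w + x + y + z ≡ dgs w + dgs x + dgs y + dgs z + 9 * (i + j + k + l)
  sum≡ = trans
    (cong₂ _+_ (cong₂ _+_ (cong₂ _+_ w≡ x≡) y≡) z≡)
    (lemma (dgs w) (dgs x) (dgs y) (dgs z) i j k l)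

3∣n⇒9∣n² : ∀ {n} → 3 ∣ n → 9 ∣ n ^ 2
3∣n⇒9∣n² {n} 3∣n =
  -- `n ^ 2` unfolds to `n * (n * 1)`, hence the rewriting of `n * n`.
  subst (9 ∣_) (cong (n *_) (sym (*-identityʳ n))) (*-pres-∣ 3∣n 3∣n)

9∤prime : ∀ {p} → Prime p → 9 ∤ p
9∤prime pp 9∣p with prime⇒irreducible pp 9∣p
-- A divisor of a prime is 1 or the prime itself; 9 is not 1, and deciding primality of 9 by
-- computation excludes the other case.
... | inj₂ refl = from-no (prime? 9) pp

proposition4p2 : (x₁ x₂ x₃ x₄ a b : ℕ) →
    Prime x₁ → Prime x₂ → Prime x₃ → Prime x₄ →
    0 < a → 0 < b →
    x₁ + x₂ + x₃ + x₄ ≡ a ^ 2 →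
    dgs x₁ + dgs x₂ + dgs x₃ + dgs x₄ ≡ b ^ 2 →
    dgs (a ^ 2) + dgs (b ^ 2) ≡ dgs (a ^ 2 + b ^ 2) →
    Prime (a ^ 2 + b ^ 2) →
    (∃[ s ] (0 < s × a ^ 2 + b ^ 2 ≡ 4 * s + 1)) →
    3 ∤ b
proposition4p2 x₁ x₂ x₃ x₄ a b _ _ _ _ _ _ Σx≡a² Σdgs≡b² _ prime[a²+b²] _ 3∣b =
  9∤prime prime[a²+b²] (∣m∣n⇒∣m+n 9∣a² 9∣b²)
  where
  9∣b² : 9 ∣ b ^ 2
  9∣b² = 3∣n⇒9∣n² 3∣b

  9∣a² : 9 ∣ a ^ 2
  9∣a² = subst (9 ∣_) Σx≡a²
    (9∣sum-dgs⇒9∣sum x₁ x₂ x₃ x₄ (subst (9 ∣_) (sym Σdgs≡b²) 9∣b²))
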